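{- For every $t\in\mathbb{N}$ and $C>0$ there is $\varepsilon_0>0$ such that the following holds for every integer $m\ge 3$. If $0<\varepsilon<\varepsilon_0$ and $\mathcal{G},\mathcal{H}\subset[m]^n$ satisfy $\mu(\mathcal{H})=m^{ -t}\varepsilon$ and $\mu(\mathcal{G})>1-C\varepsilon$, then ${\sf agr}(x,y)=0$ for some $x\in\mathcal{G}$ and $y\in\mathcal{H}$.
   Context: $[m]=\{1,\dots,m\}$, $\mu$ is the uniform probability measure on $[m]^n$, and ${\sf agr}(x,y)=|\{i\in[n]:x_i=y_i\}|$. -}

module Defs where

open import Data.Nat.Base as ℕ using (ℕ; zero; suc; NonZero; _^_)
import Data.Nat.Properties as ℕ
open import Data.Integer.Base using (+_)
open import Data.Rational.Base as ℚ using (ℚ; 0ℚ; 1ℚ; ½; Positive; ∣_∣)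
import Data.Rational.Properties as ℚ
open import Data.Rational.Solver using (module +-*-Solver)
open import Data.Fin.Base using (Fin)
import Data.Fin.Properties as Fin
open import Data.List.Base using (List; []; _∷_; length; filter; allFin; cartesianProductWith)
open import Data.Vec.Base as Vec using (Vec; lookup)
open import Data.Product.Base using (∃; _×_; _,_)
open import Level using (0ℓ)
open import Relation.Unary using (Pred; Decidable)
open import Relation.Binary.PropositionalEquality using (_≡_; refl; sym; cong; cong₂; subst)

------------------------------------------------------------------------
-- Real numbers: Cauchy sequences of rationals, considered up to _≈_.

IsCauchy : (ℕ → ℚ) → Set
IsCauchy x = ∀ δ → 0ℚ ℚ.< δ → ∃ λ N → ∀ m n → N ℕ.≤ m → N ℕ.≤ n → ∣ x m ℚ.- x n ∣ ℚ.< δ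

record ℝ : Set where
  constructor mkℝ
  field
    seq    : ℕ → ℚ
    cauchy : IsCauchy seq

open ℝ public

infix 4 _≈_ _<_

_≈_ : ℝ → ℝ → Set
x ≈ y = ∀ δ → 0ℚ ℚ.< δ → ∃ λ N → ∀ n → N ℕ.≤ n → ∣ seq x n ℚ.- seq y n ∣ ℚ.< δ

-- The uniform gap δ is essential: termwise strict inequality would not be
-- invariant under _≈_.
_<_ : ℝ → ℝ → Set
x < y = ∃ λ δ → 0ℚ ℚ.< δ × ∃ λ N → ∀ n → N ℕ.≤ n → seq x n ℚ.+ δ ℚ.≤ seq y n

private
  half-pos : ∀ {δ} → 0ℚ ℚ.< δ → 0ℚ ℚ.< ½ ℚ.* δ
  half-pos {δ} 0<δ = subst (ℚ._< ½ ℚ.* δ) (ℚ.*-zeroʳ ½) (ℚ.*-monoʳ-<-pos ½ 0<δ)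

  halves : ∀ δ → ½ ℚ.* δ ℚ.+ ½ ℚ.* δ ≡ δ
  halves = solve 1 (λ d → con ½ :* d :+ con ½ :* d := d) refl
    where open +-*-Solver

  split-+ : ∀ a b c d → (a ℚ.+ b) ℚ.- (c ℚ.+ d) ≡ (a ℚ.- c) ℚ.+ (b ℚ.- d)
  split-+ = solve 4 (λ a b c d → (a :+ b) :- (c :+ d) := (a :- c) :+ (b :- d)) refl
    where open +-*-Solver

  split-* : ∀ a b c d → a ℚ.* b ℚ.- c ℚ.* d ≡ a ℚ.* (b ℚ.- d) ℚ.+ d ℚ.* (a ℚ.- c)
  split-* = solve 4 (λ a b c d → a :* b :- c :* d := a :* (b :- d) :+ d :* (a :- c)) refl
    where open +-*-Solver

  split-neg : ∀ a b → (ℚ.- a) ℚ.- (ℚ.- b) ≡ ℚ.- (a ℚ.- b)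
  split-neg = solve 2 (λ a b → (:- a) :- (:- b) := :- (a :- b)) refl
    where open +-*-Solver

  a≡b+[a-b] : ∀ a b → a ≡ b ℚ.+ (a ℚ.- b)
  a≡b+[a-b] = solve 2 (λ a b → a := b :+ (a :- b)) refl
    where open +-*-Solver

  -- Cauchy sequences are eventually bounded.
  bound : ∀ {x} → IsCauchy x →
          ∃ λ A → Positive A × ∃ λ N → ∀ n → N ℕ.≤ n → ∣ x n ∣ ℚ.≤ A
  bound {x} c with c 1ℚ (ℚ.positive⁻¹ 1ℚ)
  ... | N , close = ∣ x N ∣ ℚ.+ 1ℚ
                  , ℚ.positive (ℚ.+-mono-≤-< (ℚ.0≤∣p∣ (x N)) (ℚ.positive⁻¹ 1ℚ))
                  , N , λ n N≤n → begin
    ∣ x n ∣                         ≡⟨ cong ∣_∣ (a≡b+[a-b] (x n) (x N)) ⟩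
    ∣ x N ℚ.+ (x n ℚ.- x N) ∣       ≤⟨ ℚ.∣p+q∣≤∣p∣+∣q∣ (x N) (x n ℚ.- x N) ⟩
    ∣ x N ∣ ℚ.+ ∣ x n ℚ.- x N ∣     ≤⟨ ℚ.+-monoʳ-≤ ∣ x N ∣ (ℚ.<⇒≤ (close n N N≤n ℕ.≤-refl)) ⟩
    ∣ x N ∣ ℚ.+ 1ℚ                  ∎
    where open ℚ.≤-Reasoning

  -- For A > 0 and η > 0: some θ > 0 with a * t < η whenever a ≤ A and 0 ≤ t < θ.
  shrink : ∀ A → Positive A → ∀ η → 0ℚ ℚ.< η →
           ∃ λ θ → 0ℚ ℚ.< θ × (∀ a t → a ℚ.≤ A → 0ℚ ℚ.≤ t → t ℚ.< θ → a ℚ.* t ℚ.< η)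
  shrink A A>0 η η>0 = θ , θ>0 , small
    where
    open ℚ.≤-Reasoning
    instance
      posA : Positive A
      posA = A>0
      nzA : ℚ.NonZero A
      nzA = ℚ.pos⇒nonZero A
      posη : Positive η
      posη = ℚ.positive η>0
      pos1/A : Positive (ℚ.1/ A)
      pos1/A = ℚ.1/pos⇒pos A
    θ = ℚ.1/ A ℚ.* η
    θ>0 : 0ℚ ℚ.< θ
    θ>0 = ℚ.positive⁻¹ θ {{ℚ.pos*pos⇒pos (ℚ.1/ A) η}}
    small : ∀ a t → a ℚ.≤ A → 0ℚ ℚ.≤ t → t ℚ.< θ → a ℚ.* t ℚ.< η
    small a t a≤A 0≤t t<θ = begin-strict
      a ℚ.* t                  ≤⟨ ℚ.*-monoʳ-≤-nonNeg t {{ℚ.nonNegative 0≤t}} a≤A ⟩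
      A ℚ.* t                  <⟨ ℚ.*-monoʳ-<-pos A t<θ ⟩
      A ℚ.* (ℚ.1/ A ℚ.* η)     ≡⟨ ℚ.*-assoc A (ℚ.1/ A) η ⟨
      A ℚ.* ℚ.1/ A ℚ.* η       ≡⟨ cong (ℚ._* η) (ℚ.*-inverseʳ A) ⟩
      1ℚ ℚ.* η                 ≡⟨ ℚ.*-identityˡ η ⟩
      η                        ∎

  halves-+ : ∀ p q δ → ∣ p ∣ ℚ.< ½ ℚ.* δ → ∣ q ∣ ℚ.< ½ ℚ.* δ → ∣ p ℚ.+ q ∣ ℚ.< δ
  halves-+ p q δ p< q< = ℚ.≤-<-trans (ℚ.∣p+q∣≤∣p∣+∣q∣ p q)
    (subst (∣ p ∣ ℚ.+ ∣ q ∣ ℚ.<_) (halves δ) (ℚ.+-mono-< p< q<))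

  +-cauchy : ∀ {x y} → IsCauchy x → IsCauchy y → IsCauchy (λ n → x n ℚ.+ y n)
  +-cauchy {x} {y} cx cy δ δ>0
    with cx (½ ℚ.* δ) (half-pos δ>0) | cy (½ ℚ.* δ) (half-pos δ>0)
  ... | M , px | N , py = M ℕ.⊔ N , λ m n m≥ n≥ →
    subst (λ r → ∣ r ∣ ℚ.< δ) (sym (split-+ (x m) (y m) (x n) (y n)))
      (halves-+ (x m ℚ.- x n) (y m ℚ.- y n) δ
        (px m n (ℕ.m⊔n≤o⇒m≤o M N m≥) (ℕ.m⊔n≤o⇒m≤o M N n≥))
        (py m n (ℕ.m⊔n≤o⇒n≤o M N m≥) (ℕ.m⊔n≤o⇒n≤o M N n≥)))

  neg-cauchy : ∀ {x} → IsCauchy x → IsCauchy (λ n → ℚ.- x n)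
  neg-cauchy {x} cx δ δ>0 with cx δ δ>0
  ... | N , p = N , λ m n m≥ n≥ → begin-strict
    ∣ (ℚ.- x m) ℚ.- (ℚ.- x n) ∣   ≡⟨ cong ∣_∣ (split-neg (x m) (x n)) ⟩
    ∣ ℚ.- (x m ℚ.- x n) ∣         ≡⟨ ℚ.∣-p∣≡∣p∣ (x m ℚ.- x n) ⟩
    ∣ x m ℚ.- x n ∣               <⟨ p m n m≥ n≥ ⟩
    δ                             ∎
    where open ℚ.≤-Reasoning

  *-close : ∀ a b c d δ → ∣ a ∣ ℚ.* ∣ b ℚ.- d ∣ ℚ.< ½ ℚ.* δ → ∣ d ∣ ℚ.* ∣ a ℚ.- c ∣ ℚ.< ½ ℚ.* δ →
            ∣ a ℚ.* b ℚ.- c ℚ.* d ∣ ℚ.< δ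
  *-close a b c d δ p q =
    subst (λ r → ∣ r ∣ ℚ.< δ) (sym (split-* a b c d))
      (halves-+ (a ℚ.* (b ℚ.- d)) (d ℚ.* (a ℚ.- c)) δ
        (subst (ℚ._< ½ ℚ.* δ) (sym (ℚ.∣p*q∣≡∣p∣*∣q∣ a (b ℚ.- d))) p)
        (subst (ℚ._< ½ ℚ.* δ) (sym (ℚ.∣p*q∣≡∣p∣*∣q∣ d (a ℚ.- c))) q))

  *-cauchy : ∀ {x y} → IsCauchy x → IsCauchy y → IsCauchy (λ n → x n ℚ.* y n)
  *-cauchy {x} {y} cx cy δ δ>0 =
    let A , A>0 , K , bx = bound {x} cx
        B , B>0 , L , by = bound {y} cy
        θ , θ>0 , sA     = shrink A A>0 (½ ℚ.* δ) (half-pos δ>0)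
        φ , φ>0 , sB     = shrink B B>0 (½ ℚ.* δ) (half-pos δ>0)
        M , py           = cy θ θ>0
        N , px           = cx φ φ>0
    in (K ℕ.⊔ L) ℕ.⊔ (M ℕ.⊔ N) , λ m n m≥ n≥ →
      let m≥KL = ℕ.m⊔n≤o⇒m≤o (K ℕ.⊔ L) (M ℕ.⊔ N) m≥
          n≥KL = ℕ.m⊔n≤o⇒m≤o (K ℕ.⊔ L) (M ℕ.⊔ N) n≥
          m≥MN = ℕ.m⊔n≤o⇒n≤o (K ℕ.⊔ L) (M ℕ.⊔ N) m≥
          n≥MN = ℕ.m⊔n≤o⇒n≤o (K ℕ.⊔ L) (M ℕ.⊔ N) n≥
      in *-close (x m) (y m) (x n) (y n) δ
        (sA ∣ x m ∣ ∣ y m ℚ.- y n ∣ (bx m (ℕ.m⊔n≤o⇒m≤o K L m≥KL)) (ℚ.0≤∣p∣ (y m ℚ.- y n))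
          (py m n (ℕ.m⊔n≤o⇒m≤o M N m≥MN) (ℕ.m⊔n≤o⇒m≤o M N n≥MN)))
        (sB ∣ y n ∣ ∣ x m ℚ.- x n ∣ (by n (ℕ.m⊔n≤o⇒n≤o K L n≥KL)) (ℚ.0≤∣p∣ (x m ℚ.- x n))
          (px m n (ℕ.m⊔n≤o⇒n≤o M N m≥MN) (ℕ.m⊔n≤o⇒n≤o M N n≥MN)))

infixl 6 _+_ _-_
infixl 7 _*_
infix  8 -_

fromℚ : ℚ → ℝ
fromℚ q .seq _ = q
fromℚ q .cauchy δ δ>0 = 0 , λ _ _ _ _ →
  subst (λ r → ∣ r ∣ ℚ.< δ) (sym (ℚ.+-inverseʳ q)) δ>0

0ℝ 1ℝ : ℝ
0ℝ = fromℚ 0ℚ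
1ℝ = fromℚ 1ℚ

_+_ : ℝ → ℝ → ℝ
x + y = mkℝ (λ n → seq x n ℚ.+ seq y n) (+-cauchy {seq x} {seq y} (cauchy x) (cauchy y))

-_ : ℝ → ℝ
- x = mkℝ (λ n → ℚ.- seq x n) (neg-cauchy {seq x} (cauchy x))

_-_ : ℝ → ℝ → ℝ
x - y = x + (- y)

_*_ : ℝ → ℝ → ℝ
x * y = mkℝ (λ n → seq x n ℚ.* seq y n) (*-cauchy {seq x} {seq y} (cauchy x) (cauchy y))

-- m ^- t is the real number m⁻ᵗ.
infix 9 _^-_

_^-_ : (m t : ℕ) .{{_ : NonZero m}} → ℝ
m ^- t = fromℚ (ℚ._/_ (+ 1) (m ^ t) {{ℕ.m^n≢0 m t}})

------------------------------------------------------------------------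
-- The space [m]ⁿ.  The alphabet {1,…,m} is represented by Fin m.

[_]^_ : ℕ → ℕ → Set
[ m ]^ n = Vec (Fin m) n

-- Every point of [m]ⁿ exactly once.
points : ∀ m n → List ([ m ]^ n)
points m zero    = Vec.[] ∷ []
points m (suc n) = cartesianProductWith Vec._∷_ (allFin m) (points m n)

-- Uniform measure.  Subsets of the finite set [m]ⁿ are decidable predicates.
μ : ∀ {m n} .{{_ : NonZero m}} {S : Pred ([ m ]^ n) 0ℓ} → Decidable S → ℝ
μ {m} {n} S? = fromℚ (ℚ._/_ (+ length (filter S? (points m n))) (m ^ n) {{ℕ.m^n≢0 m n}})

agr : ∀ {m n} → [ m ]^ n → [ m ]^ n → ℕ
agr {n = n} x y = Vec.count (λ i → lookup x i Fin.≟ lookup y i) (Vec.allFin n)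

{-# OPTIONS --safe #-}
module Submission where

-- Let m = k + 1 and let N be the set of points disagreeing everywhere with some point
-- of H. Then μ(H) ≤ μ(N)ᵏ, by induction on n: splitting along the first coordinate, the
-- slices satisfy μ(Hᵢ) ≤ μ(Nⱼ)ᵏ whenever i ≠ j, so if b ≤ a are the two smallest μ(Nⱼ),
-- it suffices that (aᵏ + k bᵏ)/m ≤ ((k a + b)/m)ᵏ. If G misses N then μ(N) ≤ Cε, and since
-- m ≤ 2ᵏ this gives ε = mᵗ μ(H) ≤ (2ᵗCε)ᵏ ≤ (2ᵗCε)² once 2ᵗCε ≤ 1, as k ≥ 2;
-- this fails for small ε.

open import Defs using ([_]^_; points; agr)
open import Data.Bool.Base using (true; false)
open import Data.Nat.Base as ℕ using (ℕ; zero; suc; NonZero; _≤_; z≤n; s≤s)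
import Data.Nat.Coprimality as Coprimality
import Data.Nat.Properties as ℕ
import Data.Integer.Base as ℤ
import Data.Integer.Properties as ℤ
import Data.Rational.Base as ℚ
open ℚ using (ℚ; mkℚ; 0ℚ; 1ℚ; ½; Positive; NonNegative)
import Data.Rational.Properties as ℚ
open import Data.Rational.Solver using (module +-*-Solver)
import Data.Rational.Unnormalised.Base as ℚᵘ
import Data.Rational.Unnormalised.Properties as ℚᵘ
open import Data.Fin.Base using (Fin; zero; suc; punchIn)
import Data.Fin.Properties as Fin
open import Data.List.Base as List
  using ([]; _∷_; _++_; length; filter; map; allFin; cartesianProductWith)
open import Data.List.Membership.Propositional using (_∈_; lose)
open import Data.List.Membership.Propositional.Properties
  using (∈-allFin; ∈-cartesianProductWith⁺)
import Data.List.Properties as List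
import Data.List.Relation.Unary.Any as Any
open import Data.Product.Base using (∃; _×_; _,_; proj₁; proj₂)
open import Data.Sum.Base using (inj₁; inj₂)
open import Data.Vec.Base as Vec using (Vec; []; _∷_; lookup)
open import Function.Base using (_∘_; id)
open import Level using (0ℓ)
open import Relation.Binary.PropositionalEquality
  using (_≡_; _≢_; refl; sym; trans; cong; cong₂; subst; module ≡-Reasoning)
open import Relation.Nullary using (¬_; Dec; yes; no; does; contradiction)
open import Relation.Nullary.Decidable using (map′; _×-dec_; decidable-stable)
open import Relation.Unary using (Pred; Decidable)
open import Relation.Unary.Properties using (∁?)

module _ where
  open import Data.Nat.Base using (_+_; _*_; _^_)
  open import Data.Nat.Solver using () renaming (module +-*-Solver to ℕ-Solver)
  open ℕ-Solver
  open import Algebra.Properties.CommutativeMonoid.Sum ℕ.+-0-commutativeMonoid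
    using (sum; sum-remove)
  open ℕ.≤-Reasoning

  -- Power inequalities over the natural numbers

  ^-distribʳ-* : ∀ n x y → (x * y) ^ n ≡ x ^ n * y ^ n
  ^-distribʳ-* zero    x y = refl
  ^-distribʳ-* (suc n) x y = trans (cong (x * y *_) (^-distribʳ-* n x y))
    (solve 4 (λ x y p q → x :* y :* (p :* q) := x :* p :* (y :* q)) refl x y (x ^ n) (y ^ n))

  n<2^n : ∀ n → suc n ≤ 2 ^ n
  n<2^n zero    = ℕ.≤-refl
  n<2^n (suc n) = ℕ.+-mono-≤ (ℕ.m^n>0 2 n) (ℕ.≤-trans (n<2^n n) (ℕ.m≤m+n (2 ^ n) 0))

  -- Induction on `j` with `x = y + d`: the terms with factor `y` are the induction hypothesis, and
  -- those with factor `b` or `d` are dominated by the largest power `X`. This is convexity of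
  -- powers, stated additively to avoid truncated subtraction.
  ^-increment-mono : ∀ {x y} b j → y ≤ x → (y + b) ^ j + x ^ j ≤ (x + b) ^ j + y ^ j
  ^-increment-mono b zero    _   = ℕ.≤-refl
  ^-increment-mono {x} {y} b (suc j) y≤x with ℕ.m≤n⇒∃[o]m+o≡n y≤x
  ... | d , refl = begin
    (y + b) * Y + (y + d) * p          ≡⟨ solve 5 (λ y b Y d p → (y :+ b) :* Y :+ (y :+ d) :* p
                                            := y :* (Y :+ p) :+ (b :* Y :+ d :* p)) refl y b Y d p ⟩
    y * (Y + p) + (b * Y + d * p)      ≤⟨ ℕ.+-mono-≤ (ℕ.*-monoʳ-≤ y (^-increment-mono b j y≤x))
                                            (ℕ.+-mono-≤ (ℕ.*-monoʳ-≤ b (ℕ.^-monoˡ-≤ j (ℕ.+-monoˡ-≤ b y≤x)))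
                                              (ℕ.*-monoʳ-≤ d (ℕ.^-monoˡ-≤ j (ℕ.m≤m+n (y + d) b)))) ⟩
    y * (X + q) + (b * X + d * X)      ≡⟨ solve 5 (λ y X q b d → y :* (X :+ q) :+ (b :* X :+ d :* X)
                                            := (y :+ d :+ b) :* X :+ y :* q) refl y X q b d ⟩
    (y + d + b) * X + y * q            ∎
    where
    Y = (y + b) ^ j
    X = (y + d + b) ^ j
    p = (y + d) ^ j
    q = y ^ j

  -- Bernoulli's inequality (1 − 1/(k+1))ⁱ ≥ 1 − i/(k+1), cleared of denominators.
  bernoulli : ∀ k i r → i + r ≡ suc k → suc k ^ i * r ≤ k ^ i * suc k
  bernoulli k zero    r refl = ℕ.≤-refl
  bernoulli k (suc i) r eq   = begin
    suc k * suc k ^ i * r      ≡⟨ solve 3 (λ c x r → c :* x :* r := x :* (c :* r)) refl (suc k) (suc k ^ i) r ⟩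
    -- Here `suc k * r = r + k * r`, and `r ≤ k` trades one factor `suc k` for `k` while `r` becomes
    -- `suc r`.
    suc k ^ i * (suc k * r)    ≤⟨ ℕ.*-monoʳ-≤ (suc k ^ i) (ℕ.+-monoˡ-≤ (k * r) r≤k) ⟩
    suc k ^ i * (k + k * r)    ≡⟨ solve 3 (λ x k r → x :* (k :+ k :* r) := k :* (x :* (con 1 :+ r))) refl (suc k ^ i) k r ⟩
    k * (suc k ^ i * suc r)    ≤⟨ ℕ.*-monoʳ-≤ k (bernoulli k i (suc r) (trans (ℕ.+-suc i r) eq)) ⟩
    k * (k ^ i * suc k)        ≡⟨ ℕ.*-assoc k (k ^ i) (suc k) ⟨
    k * k ^ i * suc k          ∎
    where
    r≤k : r ≤ k
    r≤k = subst (r ≤_) (ℕ.suc-injective eq) (ℕ.m≤n+m r i)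

  -- The last case `i = k`, `r = 1` of `bernoulli`, with one factor `k + 1` cancelled (`k = suc j`).
  [1+k]^[k-1]≤k^k : ∀ j → suc (suc j) ^ j ≤ suc j ^ suc j
  [1+k]^[k-1]≤k^k j = ℕ.*-cancelˡ-≤ (suc (suc j)) (begin
    suc (suc j) ^ suc j            ≡⟨ ℕ.*-identityʳ _ ⟨
    suc (suc j) ^ suc j * 1        ≤⟨ bernoulli (suc j) (suc j) 1 (ℕ.+-comm (suc j) 1) ⟩
    suc j ^ suc j * suc (suc j)    ≡⟨ ℕ.*-comm (suc j ^ suc j) (suc (suc j)) ⟩
    suc (suc j) * suc j ^ suc j    ∎)

  -- The increments of x ↦ xᵏ over [x, x + b] at x = k b and x = k a are compared; the excess
  -- of kᵏ over (k+1)ᵏ⁻¹ then only multiplies aᵏ − bᵏ ≥ 0.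
  two-value-inequality : ∀ j {a b} → b ≤ a → let k = suc j in
    suc k ^ j * (a ^ k + k * b ^ k) ≤ (k * a + b) ^ k
  two-value-inequality j {a} {b} b≤a with ℕ.m≤n⇒∃[o]m+o≡n ([1+k]^[k-1]≤k^k j)
  -- The added `k ^ k * B = (e + f) * B` completes `k * e * B` to `suc k * e * B`, which is
  -- `(suc k * b) ^ k`, and leaves `f * B` to be raised to `f * A`.
  ... | f , e+f≡k^k = ℕ.+-cancelʳ-≤ ((e + f) * B) _ _ (begin
    e * (A + k * B) + (e + f) * B      ≡⟨ solve 5 (λ e f k A B → e :* (A :+ k :* B) :+ (e :+ f) :* B
                                            := (con 1 :+ k) :* e :* B :+ (e :* A :+ f :* B)) refl e f k A B ⟩
    suc k * e * B + (e * A + f * B)    ≤⟨ ℕ.+-monoʳ-≤ (suc k * e * B) (ℕ.+-monoʳ-≤ (e * A)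
                                            (ℕ.*-monoʳ-≤ f (ℕ.^-monoˡ-≤ k b≤a))) ⟩
    suc k * e * B + (e * A + f * A)    ≡⟨ cong₂ _+_ (sym (^-distribʳ-* k (suc k) b)) (sym (ℕ.*-distribʳ-+ A e f)) ⟩
    (suc k * b) ^ k + (e + f) * A      ≡⟨ cong (λ c → (suc k * b) ^ k + c * A) e+f≡k^k ⟩
    (b + k * b) ^ k + k ^ k * A        ≡⟨ cong₂ _+_ (cong (_^ k) (ℕ.+-comm b (k * b))) (sym (^-distribʳ-* k k a)) ⟩
    (k * b + b) ^ k + (k * a) ^ k      ≤⟨ ^-increment-mono b k (ℕ.*-monoʳ-≤ k b≤a) ⟩
    (k * a + b) ^ k + (k * b) ^ k      ≡⟨ cong ((k * a + b) ^ k +_) (^-distribʳ-* k k b) ⟩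
    (k * a + b) ^ k + k ^ k * B        ≡⟨ cong (λ c → (k * a + b) ^ k + c * B) e+f≡k^k ⟨
    (k * a + b) ^ k + (e + f) * B      ∎)
    where
    k = suc j
    e = suc k ^ j
    A = a ^ k
    B = b ^ k

  -- Minima, finite sums and the inequality between slices

  minimum : ∀ {n} (f : Fin (suc n) → ℕ) → ∃ λ i → ∀ j → f i ≤ f j
  minimum {zero}  f = zero , λ { zero → ℕ.≤-refl }
  minimum {suc n} f with minimum (f ∘ suc)
  ... | i , fi≤ with ℕ.≤-total (f zero) (f (suc i))
  ...   | inj₁ f0≤fi = zero  , λ { zero → ℕ.≤-refl ; (suc j) → ℕ.≤-trans f0≤fi (fi≤ j) }
  ...   | inj₂ fi≤f0 = suc i , λ { zero → fi≤f0 ; (suc j) → fi≤ j }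

  sum-≤ : ∀ {n} (f : Fin n → ℕ) {c} → (∀ i → f i ≤ c) → sum f ≤ n * c
  sum-≤ {zero}  f f≤c = z≤n
  sum-≤ {suc n} f f≤c = ℕ.+-mono-≤ (f≤c zero) (sum-≤ (f ∘ suc) (f≤c ∘ suc))

  sum-≥ : ∀ {n} (f : Fin n → ℕ) {c} → (∀ i → c ≤ f i) → n * c ≤ sum f
  sum-≥ {zero}  f c≤f = z≤n
  sum-≥ {suc n} f c≤f = ℕ.+-mono-≤ (c≤f zero) (sum-≥ (f ∘ suc) (c≤f ∘ suc))

  sum-*ʳ : ∀ {n} (f : Fin n → ℕ) c → sum (λ i → f i * c) ≡ sum f * c
  sum-*ʳ {zero}  f c = refl
  sum-*ʳ {suc n} f c = trans (cong (f zero * c +_) (sum-*ʳ (f ∘ suc) c))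
                             (sym (ℕ.*-distribʳ-+ c (f zero) (sum (f ∘ suc))))

  -- Let `b = ν i` be the least value and `a` the least of the others. Then `η i` is at most
  -- `a ^ k`, the other `k` values of `η` are at most `b ^ k`, and `sum ν` is at least `b + k * a`,
  -- so `two-value-inequality` applies. The factor `m ^ j` remains after both sums are averaged over
  -- `m` terms and denominators are cleared.
  cross-power-sum : ∀ j (η ν : Fin (suc (suc j)) → ℕ) →
    (∀ i l → i ≢ l → η i ≤ ν l ^ suc j) →
    suc (suc j) ^ j * sum η ≤ sum ν ^ suc j
  cross-power-sum j η ν η≤ν with minimum ν
  ... | i , νi≤ with minimum (ν ∘ punchIn i)
  ...   | l , νl≤ = begin
    m ^ j * sum η                             ≡⟨ cong (m ^ j *_) (sum-remove {i = i} η) ⟩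
    m ^ j * (η i + sum (η ∘ punchIn i))       ≤⟨ ℕ.*-monoʳ-≤ (m ^ j) (ℕ.+-mono-≤
                                                   (η≤ν i (punchIn i l) (Fin.punchInᵢ≢i i l ∘ sym))
                                                   (sum-≤ (η ∘ punchIn i) λ i′ → η≤ν (punchIn i i′) i (Fin.punchInᵢ≢i i i′))) ⟩
    m ^ j * (a ^ k + k * b ^ k)               ≤⟨ two-value-inequality j (νi≤ (punchIn i l)) ⟩
    (k * a + b) ^ k                           ≡⟨ cong (_^ k) (ℕ.+-comm (k * a) b) ⟩
    (b + k * a) ^ k                           ≤⟨ ℕ.^-monoˡ-≤ k (ℕ.+-monoʳ-≤ b (sum-≥ (ν ∘ punchIn i) νl≤)) ⟩
    (b + sum (ν ∘ punchIn i)) ^ k             ≡⟨ cong (_^ k) (sum-remove {i = i} ν) ⟨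
    sum ν ^ k                                 ∎
    where
    k = suc j
    m = suc k
    b = ν i
    a = ν (punchIn i l)

  -- Counting points and slices

  length-filter-map : ∀ {A B : Set} {P : Pred B 0ℓ} (P? : Decidable P) (f : A → B) xs →
    length (filter P? (map f xs)) ≡ length (filter (P? ∘ f) xs)
  length-filter-map P? f []       = refl
  length-filter-map P? f (x ∷ xs) with does (P? (f x))
  ... | true  = cong suc (length-filter-map P? f xs)
  ... | false = length-filter-map P? f xs

  length-filter-∁ : ∀ {A : Set} {P : Pred A 0ℓ} (P? : Decidable P) xs →
    length (filter P? xs) + length (filter (∁? P?) xs) ≡ length xs
  length-filter-∁ P? []       = refl
  length-filter-∁ P? (x ∷ xs) with does (P? x)
  ... | true  = cong suc (length-filter-∁ P? xs)
  ... | false = trans (ℕ.+-suc _ _) (cong suc (length-filter-∁ P? xs))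

  card : ∀ {m n} {S : Pred ([ m ]^ n) 0ℓ} → Decidable S → ℕ
  card {m} {n} S? = length (filter S? (points m n))

  slice? : ∀ {m n} {S : Pred ([ m ]^ suc n) 0ℓ} → Decidable S →
           (i : Fin m) → Decidable (S ∘ (i ∷_))
  slice? S? i = S? ∘ (i ∷_)

  card-slices : ∀ {m n} {S : Pred ([ m ]^ suc n) 0ℓ} (S? : Decidable S) →
    card S? ≡ sum (card ∘ slice? S?)
  card-slices {m} {n} S? = go id
    where
    -- Since `allFin m` is `tabulate id`, the induction is over an arbitrary `g` in place of `id`:
    -- its domain shrinks while the alphabet stays `Fin m`.
    go : ∀ {l} (g : Fin l → Fin m) →
      length (filter S? (cartesianProductWith _∷_ (List.tabulate g) (points m n)))
        ≡ sum (card ∘ slice? S? ∘ g)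
    go {zero}  g = refl
    go {suc l} g = begin-equality
      length (filter S? (xs ++ ys))                   ≡⟨ cong length (List.filter-++ S? xs ys) ⟩
      length (filter S? xs ++ filter S? ys)           ≡⟨ List.length-++ (filter S? xs) ⟩
      length (filter S? xs) + length (filter S? ys)   ≡⟨ cong₂ _+_ (length-filter-map S? (g zero ∷_) (points m n)) (go (g ∘ suc)) ⟩
      sum (card ∘ slice? S? ∘ g)                      ∎
      where
      xs = map (g zero ∷_) (points m n)
      ys = cartesianProductWith _∷_ (List.tabulate (g ∘ suc)) (points m n)

  length-cartesianProductWith : ∀ {A B C : Set} (f : A → B → C) xs ys →
    length (cartesianProductWith f xs ys) ≡ length xs * length ys
  length-cartesianProductWith f []       ys = refl
  length-cartesianProductWith f (x ∷ xs) ys = trans (List.length-++ (map (f x) ys))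
    (cong₂ _+_ (List.length-map (f x) ys) (length-cartesianProductWith f xs ys))

  length-points : ∀ m n → length (points m n) ≡ m ^ n
  length-points m zero    = refl
  length-points m (suc n) = trans (length-cartesianProductWith _∷_ (allFin m) (points m n))
    (cong₂ _*_ (List.length-tabulate {n = m} id) (length-points m n))

  -- Expansion under everywhere disagreement

  -- The condition `agr x y ≡ 0` in pointwise form, which splits along the first coordinate.
  Disagree : ∀ {m n} → [ m ]^ n → [ m ]^ n → Set
  Disagree x y = ∀ i → lookup x i ≢ lookup y i

  count-none : ∀ {A : Set} {P : Pred A 0ℓ} (P? : Decidable P) {n} (xs : Vec A n) →
    (∀ x → ¬ P x) → Vec.count P? xs ≡ 0
  count-none P? []       ¬P = refl
  count-none P? (x ∷ xs) ¬P with P? x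
  ... | yes Px = contradiction Px (¬P x)
  ... | no  _  = count-none P? xs ¬P

  disagree⇒agr≡0 : ∀ {m n} (x y : [ m ]^ n) → Disagree x y → agr x y ≡ 0
  disagree⇒agr≡0 x y = count-none (λ i → lookup x i Fin.≟ lookup y i) (Vec.allFin _)

  -- The inequality μ(H) ≤ μ(N)ᵏ with k = j + 1, cleared of denominators.
  disagreement-expansion : ∀ j n {H N : Pred ([ suc (suc j) ]^ n) 0ℓ}
    (H? : Decidable H) (N? : Decidable N) → (∀ x y → H y → Disagree x y → N x) →
    card H? * (suc (suc j) ^ n) ^ j ≤ card N? ^ suc j
  disagreement-expansion j zero H? N? H⇒N with H? [] | N? []
  ... | yes _ | yes _  = ℕ.≤-reflexive (trans (ℕ.+-identityʳ (1 ^ j)) (sym (ℕ.*-identityˡ (1 ^ j))))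
  -- Two empty words disagree vacuously, so this case cannot occur.
  ... | yes h | no ¬n  = contradiction (H⇒N [] [] h λ ()) ¬n
  ... | no _  | _      = z≤n
  disagreement-expansion j (suc n) H? N? H⇒N = begin
    card H? * (m * Q) ^ j                         ≡⟨ cong₂ _*_ (card-slices H?) (^-distribʳ-* j m Q) ⟩
    sum η * (m ^ j * Q ^ j)                       ≡⟨ solve 3 (λ s x y → s :* (x :* y) := x :* (s :* y)) refl (sum η) (m ^ j) (Q ^ j) ⟩
    m ^ j * (sum η * Q ^ j)                       ≡⟨ cong (m ^ j *_) (sum-*ʳ η (Q ^ j)) ⟨
    -- With `Q ^ j` inside the summands, the induction hypothesis bounds each of them by a power of
    -- `ν l`, as `cross-power-sum` requires.
    m ^ j * sum (λ i → η i * Q ^ j)               ≤⟨ cross-power-sum j (λ i → η i * Q ^ j) ν slices ⟩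
    sum ν ^ suc j                                 ≡⟨ cong (_^ suc j) (card-slices N?) ⟨
    card N? ^ suc j                               ∎
    where
    m = suc (suc j)
    Q = m ^ n
    η = card ∘ slice? H?
    ν = card ∘ slice? N?
    -- Prefixing distinct letters preserves disagreement, so slice `l` of `N` contains every point
    -- that disagrees with a point of slice `i` of `H`.
    slices : ∀ i l → i ≢ l → η i * Q ^ j ≤ ν l ^ suc j
    slices i l i≢l = disagreement-expansion j n (slice? H? i) (slice? N? l) λ x y h x#y →
      H⇒N (l ∷ x) (i ∷ y) h λ { zero → i≢l ∘ sym ; (suc p) → x#y p }

  -- The bound `m ≤ 2 ^ k` turns `m ^ t` into `(2 ^ t) ^ k`, which merges with `card N? ^ k` into
  -- `v ^ k`. As `k = 2 + j`, two factors `v` are kept and the other `j` are bounded by `P`. The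
  -- constant `2 ^ t` in `v` does not depend on `m`, whence a threshold uniform in `m`.
  small-expansion : ∀ j n t {H N : Pred ([ 3 + j ]^ n) 0ℓ}
    (H? : Decidable H) (N? : Decidable N) → (∀ x y → H y → Disagree x y → N x) →
    let m = 3 + j ; P = m ^ n ; v = 2 ^ t * card N? in
    v ≤ P → m ^ t * card H? * P ≤ v * v
  small-expansion j n t H? N? H⇒N v≤P = ℕ.*-cancelʳ-≤ _ _ (P ^ j) {{ℕ.m^n≢0 P j {{ℕ.m^n≢0 m n}}}} (begin
    m ^ t * h * P * P ^ j                   ≡⟨ ℕ.*-assoc (m ^ t * h) P (P ^ j) ⟩
    m ^ t * h * P ^ suc j                   ≡⟨ ℕ.*-assoc (m ^ t) h (P ^ suc j) ⟩
    m ^ t * (h * P ^ suc j)                 ≤⟨ ℕ.*-mono-≤ (ℕ.^-monoˡ-≤ t m≤2^k) (disagreement-expansion (suc j) n H? N? H⇒N) ⟩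
    (2 ^ k) ^ t * u ^ k                     ≡⟨ cong (_* u ^ k) (trans (ℕ.^-*-assoc 2 k t)
                                                 (trans (cong (2 ^_) (ℕ.*-comm k t)) (sym (ℕ.^-*-assoc 2 t k)))) ⟩
    (2 ^ t) ^ k * u ^ k                     ≡⟨ ^-distribʳ-* k (2 ^ t) u ⟨
    v * (v * v ^ j)                         ≡⟨ ℕ.*-assoc v v (v ^ j) ⟨
    v * v * v ^ j                           ≤⟨ ℕ.*-monoʳ-≤ (v * v) (ℕ.^-monoˡ-≤ j v≤P) ⟩
    v * v * P ^ j                           ∎)
    where
    k = suc (suc j)
    m = suc k
    P = m ^ n
    h = card H?
    u = card N?
    v = 2 ^ t * u
    m≤2^k : m ≤ 2 ^ k
    m≤2^k = n<2^n k

open import Defs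
open import Data.Integer.Base using (+_)

-- Exhaustive search in the finite space

∈-points : ∀ {m n} (x : [ m ]^ n) → x ∈ points m n
∈-points []      = Any.here refl
∈-points (i ∷ x) = ∈-cartesianProductWith⁺ _∷_ (∈-allFin i) (∈-points x)

∃-point? : ∀ {m n} {S : Pred ([ m ]^ n) 0ℓ} → Decidable S → Dec (∃ S)
∃-point? S? = map′ Any.satisfied (λ (x , s) → lose (∈-points x) s) (Any.any? S? (points _ _))

-- Natural numbers and fractions in the rationals

-- Built as a reduced fraction instead of `+ n / 1`, so that the numerator is exposed without
-- computing a gcd.
fromℕ : ℕ → ℚ
fromℕ n = mkℚ (+ n) 0 (Coprimality.sym (Coprimality.1-coprimeTo n))

instance
  fromℕ-nonNeg : ∀ {n} → NonNegative (fromℕ n)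
  fromℕ-nonNeg = _

fromℕ-mono-≤ : ∀ {m n} → m ≤ n → fromℕ m ℚ.≤ fromℕ n
fromℕ-mono-≤ m≤n = ℚ.*≤* (ℤ.*-monoʳ-≤-nonNeg (+ 1) (ℤ.+≤+ m≤n))

fromℕ-cancel-≤ : ∀ {m n} → fromℕ m ℚ.≤ fromℕ n → m ≤ n
fromℕ-cancel-≤ (ℚ.*≤* m≤n) = ℤ.drop‿+≤+ (ℤ.*-cancelʳ-≤-pos _ _ (+ 1) m≤n)

fromℕ-homo-+ : ∀ m n → fromℕ (m ℕ.+ n) ≡ fromℕ m ℚ.+ fromℕ n
fromℕ-homo-+ m n = ℚ.toℚᵘ-injective (ℚᵘ.≃-trans
  (ℚᵘ.*≡* (cong (ℤ._* + 1) (sym (cong₂ ℤ._+_ (ℤ.*-identityʳ (+ m)) (ℤ.*-identityʳ (+ n))))))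
  (ℚᵘ.≃-sym (ℚ.toℚᵘ-homo-+ (fromℕ m) (fromℕ n))))

fromℕ-homo-* : ∀ m n → fromℕ (m ℕ.* n) ≡ fromℕ m ℚ.* fromℕ n
fromℕ-homo-* m n = ℚ.toℚᵘ-injective (ℚᵘ.≃-trans
  (ℚᵘ.*≡* (cong (ℤ._* + 1) (ℤ.pos-* m n)))
  (ℚᵘ.≃-sym (ℚ.toℚᵘ-homo-* (fromℕ m) (fromℕ n))))

/-*-cancel : ∀ a d .{{_ : NonZero d}} → (+ a ℚ./ d) ℚ.* fromℕ d ≡ fromℕ a
/-*-cancel a d@(suc d-1) = ℚ.toℚᵘ-injective (ℚᵘ.≃-trans (ℚ.toℚᵘ-homo-* (+ a ℚ./ d) (fromℕ d))
  (ℚᵘ.≃-trans (ℚᵘ.*-congʳ {ℚ.toℚᵘ (fromℕ d)} (ℚ.toℚᵘ-fromℚᵘ (ℚᵘ.mkℚᵘ (+ a) d-1)))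
    (ℚᵘ.*≡* (trans (ℤ.*-identityʳ _) (cong (λ k → + a ℤ.* (+ k)) (sym (ℕ.*-identityʳ d)))))))

-- Makes fractions with a common denominator multiples of one reciprocal, a form the ring solver can
-- handle.
/≡*recip : ∀ a d .{{_ : NonZero d}} → + a ℚ./ d ≡ fromℕ a ℚ.* (+ 1 ℚ./ d)
/≡*recip a d = begin
  q                       ≡⟨ ℚ.*-identityʳ q ⟨
  q ℚ.* 1ℚ                ≡⟨ cong (q ℚ.*_) (/-*-cancel 1 d) ⟨
  q ℚ.* (r ℚ.* fromℕ d)   ≡⟨ solve 3 (λ q r d → q :* (r :* d) := q :* d :* r) refl q r (fromℕ d) ⟩
  q ℚ.* fromℕ d ℚ.* r     ≡⟨ cong (ℚ._* r) (/-*-cancel a d) ⟩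
  fromℕ a ℚ.* r           ∎
  where
  open ≡-Reasoning
  open +-*-Solver
  q = + a ℚ./ d
  r = + 1 ℚ./ d

recip-pos : ∀ d .{{_ : NonZero d}} → 0ℚ ℚ.< + 1 ℚ./ d
recip-pos d = ℚ.positive⁻¹ (+ 1 ℚ./ d) {{ℚ.normalize-pos 1 d}}

/-nonNeg : ∀ a d .{{_ : NonZero d}} → NonNegative (+ a ℚ./ d)
/-nonNeg a d = ℚ.normalize-nonNeg a d

-- Order estimates and eventual bounds

*-mono-≤-nonNeg : ∀ {p q r s} → .{{NonNegative r}} → .{{NonNegative q}} →
  p ℚ.≤ q → r ℚ.≤ s → p ℚ.* r ℚ.≤ q ℚ.* s
*-mono-≤-nonNeg {q = q} {r} p≤q r≤s =
  ℚ.≤-trans (ℚ.*-monoʳ-≤-nonNeg r p≤q) (ℚ.*-monoˡ-≤-nonNeg q r≤s)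

p≤q+∣p-q∣ : ∀ p q → p ℚ.≤ q ℚ.+ ℚ.∣ p ℚ.- q ∣
p≤q+∣p-q∣ p q = begin
  p                          ≡⟨ solve 2 (λ p q → p := q :+ (p :- q)) refl p q ⟩
  q ℚ.+ (p ℚ.- q)            ≤⟨ ℚ.+-monoʳ-≤ q (p≤∣p∣ (p ℚ.- q)) ⟩
  q ℚ.+ ℚ.∣ p ℚ.- q ∣        ∎
  where
  open ℚ.≤-Reasoning
  open +-*-Solver
  p≤∣p∣ : ∀ p → p ℚ.≤ ℚ.∣ p ∣
  p≤∣p∣ (mkℚ (+ n)       d c) = ℚ.≤-refl
  p≤∣p∣ (mkℚ ℤ.-[1+ n ]  d c) = ℚ.*≤* ℤ.-≤+

∣p-q∣≡∣q-p∣ : ∀ p q → ℚ.∣ p ℚ.- q ∣ ≡ ℚ.∣ q ℚ.- p ∣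
∣p-q∣≡∣q-p∣ p q = trans (sym (ℚ.∣-p∣≡∣p∣ (p ℚ.- q)))
  (cong ℚ.∣_∣ (solve 2 (λ p q → :- (p :- q) := q :- p) refl p q))
  where open +-*-Solver

p≤p+q : ∀ p q → 0ℚ ℚ.< q → p ℚ.≤ p ℚ.+ q
p≤p+q p q 0<q = subst (ℚ._≤ p ℚ.+ q) (ℚ.+-identityʳ p) (ℚ.+-monoʳ-≤ p (ℚ.<⇒≤ 0<q))

-- The tail stays within 1 of `c = seq x N`. Using `∣ c ∣` in place of `c` also gives `1 ≤ A`,
-- needed for the hypothesis of `square-threshold`.
upper-bound : ∀ (x : ℝ) → ∃ λ A → 1ℚ ℚ.≤ A × ∃ λ N → ∀ n → N ≤ n → seq x n ℚ.≤ A
upper-bound x with cauchy x 1ℚ (ℚ.positive⁻¹ 1ℚ)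
... | N , close = ℚ.∣ c ∣ ℚ.+ 1ℚ , 1≤A , N , λ n N≤n → begin
  seq x n                              ≤⟨ p≤q+∣p-q∣ (seq x n) c ⟩
  c ℚ.+ ℚ.∣ seq x n ℚ.- c ∣            ≤⟨ ℚ.+-mono-≤ c≤∣c∣ (ℚ.<⇒≤ (close n N N≤n ℕ.≤-refl)) ⟩
  ℚ.∣ c ∣ ℚ.+ 1ℚ                       ∎
  where
  open ℚ.≤-Reasoning
  c = seq x N
  1≤A : 1ℚ ℚ.≤ ℚ.∣ c ∣ ℚ.+ 1ℚ
  1≤A = ℚ.+-monoˡ-≤ 1ℚ (ℚ.0≤∣p∣ c)
  c≤∣c∣ : c ℚ.≤ ℚ.∣ c ∣
  c≤∣c∣ = subst (c ℚ.≤_) (trans (ℚ.+-identityˡ _) (cong ℚ.∣_∣ (ℚ.+-identityʳ c))) (p≤q+∣p-q∣ c 0ℚ)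

-- Densities and their expansion

-- The rational whose constant sequence is `μ S?`.
density : ∀ {m n} .{{_ : NonZero m}} {S : Pred ([ m ]^ n) 0ℓ} → Decidable S → ℚ
density {m} {n} S? = ℚ._/_ (+ card S?) (m ℕ.^ n) {{ℕ.m^n≢0 m n}}

density-nonNeg : ∀ {m n} .{{_ : NonZero m}} {S : Pred ([ m ]^ n) 0ℓ} (S? : Decidable S) →
  0ℚ ℚ.≤ density S?
density-nonNeg {m} {n} S? =
  ℚ.nonNegative⁻¹ (density S?) {{/-nonNeg (card S?) (m ℕ.^ n) {{ℕ.m^n≢0 m n}}}}

density-∁ : ∀ {m n} .{{_ : NonZero m}} {S : Pred ([ m ]^ n) 0ℓ} (S? : Decidable S) →
  density S? ℚ.+ density (∁? S?) ≡ 1ℚ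
density-∁ {m} {n} S? = begin
  density S? ℚ.+ density (∁? S?)                     ≡⟨ cong₂ ℚ._+_ (/≡*recip (card S?) P) (/≡*recip (card (∁? S?)) P) ⟩
  fromℕ (card S?) ℚ.* r ℚ.+ fromℕ (card (∁? S?)) ℚ.* r ≡⟨ ℚ.*-distribʳ-+ r (fromℕ (card S?)) (fromℕ (card (∁? S?))) ⟨
  (fromℕ (card S?) ℚ.+ fromℕ (card (∁? S?))) ℚ.* r   ≡⟨ cong (ℚ._* r) (fromℕ-homo-+ (card S?) (card (∁? S?))) ⟨
  fromℕ (card S? ℕ.+ card (∁? S?)) ℚ.* r             ≡⟨ cong (λ l → fromℕ l ℚ.* r)
                                                          (trans (length-filter-∁ S? (points m n)) (length-points m n)) ⟩
  fromℕ P ℚ.* r                                      ≡⟨ ℚ.*-comm (fromℕ P) r ⟩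
  r ℚ.* fromℕ P                                      ≡⟨ /-*-cancel 1 P ⟩
  1ℚ                                                 ∎
  where
  open ≡-Reasoning
  P = m ℕ.^ n
  instance
    P≢0 : NonZero P
    P≢0 = ℕ.m^n≢0 m n
  r = + 1 ℚ./ P

-- The inequality in natural numbers is divided by `M * P * P`; its premise `c * u ≤ P` is `v ≤ 1`
-- multiplied by `P`.
fraction-expansion : ∀ P M c u h .{{_ : NonZero P}} .{{_ : NonZero M}} →
  (c ℕ.* u ≤ P → M ℕ.* h ℕ.* P ≤ (c ℕ.* u) ℕ.* (c ℕ.* u)) →
  let v = fromℕ c ℚ.* (+ u ℚ./ P) in
  v ℚ.≤ 1ℚ → + h ℚ./ P ℚ.≤ (+ 1 ℚ./ M) ℚ.* (v ℚ.* v)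
fraction-expansion P M c u h expand v≤1 = begin
  + h ℚ./ P                                          ≡⟨ /≡*recip h P ⟩
  fromℕ h ℚ.* r                                      ≡⟨ clear-denominators (fromℕ h) (fromℕ M) (fromℕ P) w r
                                                          (/-*-cancel 1 M) rP≡1 ⟩
  fromℕ M ℚ.* fromℕ h ℚ.* fromℕ P ℚ.* (w ℚ.* r ℚ.* r)
    ≡⟨ cong (ℚ._* (w ℚ.* r ℚ.* r)) (trans (fromℕ-homo-* (M ℕ.* h) P) (cong (ℚ._* fromℕ P) (fromℕ-homo-* M h))) ⟨
  fromℕ (M ℕ.* h ℕ.* P) ℚ.* (w ℚ.* r ℚ.* r)          ≤⟨ ℚ.*-monoʳ-≤-nonNeg (w ℚ.* r ℚ.* r) (fromℕ-mono-≤ (expand v′≤P)) ⟩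
  fromℕ (v′ ℕ.* v′) ℚ.* (w ℚ.* r ℚ.* r)              ≡⟨ cong (ℚ._* (w ℚ.* r ℚ.* r)) (fromℕ-homo-* v′ v′) ⟩
  fromℕ v′ ℚ.* fromℕ v′ ℚ.* (w ℚ.* r ℚ.* r)          ≡⟨ regroup (fromℕ v′) w r ⟩
  w ℚ.* ((fromℕ v′ ℚ.* r) ℚ.* (fromℕ v′ ℚ.* r))      ≡⟨ cong (λ x → w ℚ.* (x ℚ.* x)) v≡v′r ⟨
  w ℚ.* (v ℚ.* v)                                    ∎
  where
  open ℚ.≤-Reasoning
  open +-*-Solver
  v′ = c ℕ.* u
  v = fromℕ c ℚ.* (+ u ℚ./ P)
  r = + 1 ℚ./ P
  w = + 1 ℚ./ M
  clear-denominators : ∀ h M P w r → w ℚ.* M ≡ 1ℚ → r ℚ.* P ≡ 1ℚ →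
    h ℚ.* r ≡ M ℚ.* h ℚ.* P ℚ.* (w ℚ.* r ℚ.* r)
  clear-denominators h M P w r wM≡1 rP≡1 = begin-equality
    h ℚ.* r                                  ≡⟨ solve 2 (λ h r → h :* r := con 1ℚ :* (h :* r) :* con 1ℚ) refl h r ⟩
    1ℚ ℚ.* (h ℚ.* r) ℚ.* 1ℚ                  ≡⟨ cong₂ (λ x y → x ℚ.* (h ℚ.* r) ℚ.* y) wM≡1 rP≡1 ⟨
    w ℚ.* M ℚ.* (h ℚ.* r) ℚ.* (r ℚ.* P)      ≡⟨ solve 5 (λ w M h r P → w :* M :* (h :* r) :* (r :* P)
                                                  := M :* h :* P :* (w :* r :* r)) refl w M h r P ⟩
    M ℚ.* h ℚ.* P ℚ.* (w ℚ.* r ℚ.* r)        ∎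
  regroup : ∀ v w r → v ℚ.* v ℚ.* (w ℚ.* r ℚ.* r) ≡ w ℚ.* ((v ℚ.* r) ℚ.* (v ℚ.* r))
  regroup = solve 3 (λ v w r → v :* v :* (w :* r :* r) := w :* ((v :* r) :* (v :* r))) refl
  rP≡1 : r ℚ.* fromℕ P ≡ 1ℚ
  rP≡1 = /-*-cancel 1 P
  v≡v′r : v ≡ fromℕ v′ ℚ.* r
  v≡v′r = begin-equality
    fromℕ c ℚ.* (+ u ℚ./ P)        ≡⟨ cong (fromℕ c ℚ.*_) (/≡*recip u P) ⟩
    fromℕ c ℚ.* (fromℕ u ℚ.* r)    ≡⟨ ℚ.*-assoc (fromℕ c) (fromℕ u) r ⟨
    fromℕ c ℚ.* fromℕ u ℚ.* r      ≡⟨ cong (ℚ._* r) (fromℕ-homo-* c u) ⟨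
    fromℕ v′ ℚ.* r                 ∎
  instance
    r≥0 : NonNegative r
    r≥0 = /-nonNeg 1 P
    w≥0 : NonNegative w
    w≥0 = /-nonNeg 1 M
    wr≥0 : NonNegative (w ℚ.* r)
    wr≥0 = ℚ.nonNeg*nonNeg⇒nonNeg w r
    wrr≥0 : NonNegative (w ℚ.* r ℚ.* r)
    wrr≥0 = ℚ.nonNeg*nonNeg⇒nonNeg (w ℚ.* r) r
  v′≤P : v′ ≤ P
  v′≤P = fromℕ-cancel-≤ (begin
    fromℕ v′                       ≡⟨ ℚ.*-identityʳ (fromℕ v′) ⟨
    fromℕ v′ ℚ.* 1ℚ                ≡⟨ cong (fromℕ v′ ℚ.*_) rP≡1 ⟨
    fromℕ v′ ℚ.* (r ℚ.* fromℕ P)   ≡⟨ ℚ.*-assoc (fromℕ v′) r (fromℕ P) ⟨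
    fromℕ v′ ℚ.* r ℚ.* fromℕ P     ≡⟨ cong (ℚ._* fromℕ P) v≡v′r ⟨
    v ℚ.* fromℕ P                  ≤⟨ ℚ.*-monoʳ-≤-nonNeg (fromℕ P) v≤1 ⟩
    1ℚ ℚ.* fromℕ P                 ≡⟨ ℚ.*-identityˡ (fromℕ P) ⟩
    fromℕ P                        ∎)

density-expansion : ∀ j n t {H N : Pred ([ 3 ℕ.+ j ]^ n) 0ℓ}
  (H? : Decidable H) (N? : Decidable N) → (∀ x y → H y → Disagree x y → N x) →
  let v = fromℕ (2 ℕ.^ t) ℚ.* density N? in
  v ℚ.≤ 1ℚ →
  density H? ℚ.≤ ℚ._/_ (+ 1) ((3 ℕ.+ j) ℕ.^ t) {{ℕ.m^n≢0 (3 ℕ.+ j) t}} ℚ.* (v ℚ.* v)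
density-expansion j n t H? N? H⇒N =
  fraction-expansion ((3 ℕ.+ j) ℕ.^ n) ((3 ℕ.+ j) ℕ.^ t) (2 ℕ.^ t) (card N?) (card H?)
    {{ℕ.m^n≢0 (3 ℕ.+ j) n}} {{ℕ.m^n≢0 (3 ℕ.+ j) t}} (small-expansion j n t H? N? H⇒N)

-- Choice of the threshold

-- For `e₀ = 1/(2s²)` one has `s * (s * e) ≤ ½`. This bounds `v ≤ s * e ≤ s * (s * e)` by 1, where
-- `1 ≤ s` enters, and `v * v ≤ (s * e) * (s * e)` by `½ * e`. The factor `½` leaves room for the
-- approximation error in the Cauchy sequences.
square-threshold : ∀ s → 1ℚ ℚ.≤ s → ∃ λ e₀ → 0ℚ ℚ.< e₀ ×
  (∀ e v → 0ℚ ℚ.≤ e → e ℚ.≤ e₀ → 0ℚ ℚ.≤ v → v ℚ.≤ s ℚ.* e → v ℚ.≤ 1ℚ × v ℚ.* v ℚ.≤ ½ ℚ.* e)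
square-threshold s 1≤s = e₀ , ℚ.positive⁻¹ e₀ , λ e v 0≤e e≤e₀ 0≤v v≤se → let
    instance
      e≥0 : NonNegative e
      e≥0 = ℚ.nonNegative 0≤e
      v≥0 : NonNegative v
      v≥0 = ℚ.nonNegative 0≤v
      se≥0 : NonNegative (s ℚ.* e)
      se≥0 = ℚ.nonNeg*nonNeg⇒nonNeg s e
    sse≤½ : s ℚ.* (s ℚ.* e) ℚ.≤ ½
    sse≤½ = begin
      s ℚ.* (s ℚ.* e)             ≤⟨ ℚ.*-monoˡ-≤-nonNeg s (ℚ.*-monoˡ-≤-nonNeg s e≤e₀) ⟩
      s ℚ.* (s ℚ.* e₀)            ≡⟨ cancel s (ℚ.1/ s) (ℚ.*-inverseʳ s) ⟩
      ½                           ∎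
  in (begin
    v                             ≤⟨ v≤se ⟩
    s ℚ.* e                       ≡⟨ ℚ.*-identityˡ (s ℚ.* e) ⟨
    1ℚ ℚ.* (s ℚ.* e)              ≤⟨ ℚ.*-monoʳ-≤-nonNeg (s ℚ.* e) 1≤s ⟩
    s ℚ.* (s ℚ.* e)               ≤⟨ sse≤½ ⟩
    ½                             ≤⟨ ℚ.*≤* (ℤ.+≤+ (s≤s z≤n)) ⟩
    1ℚ                            ∎) , (begin
    v ℚ.* v                       ≤⟨ *-mono-≤-nonNeg v≤se v≤se ⟩
    (s ℚ.* e) ℚ.* (s ℚ.* e)       ≡⟨ solve 2 (λ s e → (s :* e) :* (s :* e) := s :* (s :* e) :* e) refl s e ⟩
    s ℚ.* (s ℚ.* e) ℚ.* e         ≤⟨ ℚ.*-monoʳ-≤-nonNeg e sse≤½ ⟩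
    ½ ℚ.* e                       ∎)
  where
  open ℚ.≤-Reasoning
  open +-*-Solver
  instance
    s>0 : Positive s
    s>0 = ℚ.positive (ℚ.<-≤-trans (ℚ.positive⁻¹ 1ℚ) 1≤s)
    s≥0 : NonNegative s
    s≥0 = ℚ.pos⇒nonNeg s
    s≢0 : ℚ.NonZero s
    s≢0 = ℚ.pos⇒nonZero s
    s⁻¹>0 : Positive (ℚ.1/ s)
    s⁻¹>0 = ℚ.1/pos⇒pos s
    s⁻²>0 : Positive (ℚ.1/ s ℚ.* ℚ.1/ s)
    s⁻²>0 = ℚ.pos*pos⇒pos (ℚ.1/ s) (ℚ.1/ s)
  e₀ = ½ ℚ.* (ℚ.1/ s ℚ.* ℚ.1/ s)
  instance
    e₀>0 : Positive e₀
    e₀>0 = ℚ.pos*pos⇒pos ½ (ℚ.1/ s ℚ.* ℚ.1/ s)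
  cancel : ∀ s i → s ℚ.* i ≡ 1ℚ → s ℚ.* (s ℚ.* (½ ℚ.* (i ℚ.* i))) ≡ ½
  cancel s i si≡1 = begin-equality
    s ℚ.* (s ℚ.* (½ ℚ.* (i ℚ.* i)))     ≡⟨ solve 2 (λ s i → s :* (s :* (con ½ :* (i :* i)))
                                             := con ½ :* ((s :* i) :* (s :* i))) refl s i ⟩
    ½ ℚ.* ((s ℚ.* i) ℚ.* (s ℚ.* i))     ≡⟨ cong (λ x → ½ ℚ.* (x ℚ.* x)) si≡1 ⟩
    ½                                   ∎

-- Contradiction at a common index of the Cauchy sequences

complement-≤ : ∀ g u c A e → 0ℚ ℚ.≤ e → g ℚ.+ u ≡ 1ℚ → 1ℚ ℚ.- c ℚ.* e ℚ.≤ g → c ℚ.≤ A →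
  u ℚ.≤ A ℚ.* e
complement-≤ g u c A e 0≤e g+u≡1 1-ce≤g c≤A = begin
  u                            ≡⟨ solve 2 (λ g u → u := (g :+ u) :- g) refl g u ⟩
  g ℚ.+ u ℚ.- g                ≡⟨ cong (ℚ._- g) g+u≡1 ⟩
  1ℚ ℚ.- g                     ≤⟨ ℚ.+-monoʳ-≤ 1ℚ (ℚ.neg-antimono-≤ 1-ce≤g) ⟩
  1ℚ ℚ.- (1ℚ ℚ.- c ℚ.* e)      ≡⟨ solve 1 (λ x → con 1ℚ :- (con 1ℚ :- x) := x) refl (c ℚ.* e) ⟩
  c ℚ.* e                      ≤⟨ ℚ.*-monoʳ-≤-nonNeg e {{ℚ.nonNegative 0≤e}} c≤A ⟩
  A ℚ.* e                      ∎
  where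
  open ℚ.≤-Reasoning
  open +-*-Solver

-- Otherwise `h ≤ ½ * w * e`, so `h` would be at distance at least `½ * w * e ≥ ½ * w * δ` from
-- `w * e`.
close-half-≰ : ∀ w h e δ x → 0ℚ ℚ.< w → ℚ.∣ h ℚ.- w ℚ.* e ∣ ℚ.< w ℚ.* (½ ℚ.* δ) → δ ℚ.≤ e →
  x ℚ.≤ ½ ℚ.* e → ¬ h ℚ.≤ w ℚ.* x
close-half-≰ w h e δ x 0<w close δ≤e x≤½e h≤wx = ℚ.<-irrefl refl (begin-strict
  w ℚ.* e                                 ≤⟨ p≤q+∣p-q∣ (w ℚ.* e) h ⟩
  h ℚ.+ ℚ.∣ w ℚ.* e ℚ.- h ∣               ≡⟨ cong (h ℚ.+_) (∣p-q∣≡∣q-p∣ (w ℚ.* e) h) ⟩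
  h ℚ.+ ℚ.∣ h ℚ.- w ℚ.* e ∣               <⟨ ℚ.+-monoʳ-< h close ⟩
  h ℚ.+ w ℚ.* (½ ℚ.* δ)                   ≤⟨ ℚ.+-mono-≤ (ℚ.≤-trans h≤wx (ℚ.*-monoˡ-≤-nonNeg w x≤½e))
                                               (ℚ.*-monoˡ-≤-nonNeg w (ℚ.*-monoˡ-≤-nonNeg ½ δ≤e)) ⟩
  w ℚ.* (½ ℚ.* e) ℚ.+ w ℚ.* (½ ℚ.* e)     ≡⟨ solve 2 (λ w e → w :* (con ½ :* e) :+ w :* (con ½ :* e) := w :* e) refl w e ⟩
  w ℚ.* e                                 ∎)
  where
  open ℚ.≤-Reasoning
  open +-*-Solver
  instance
    w≥0 : NonNegative w
    w≥0 = ℚ.nonNegative (ℚ.<⇒≤ 0<w)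

1≤fromℕ*A : ∀ {T A} → 1 ≤ T → 1ℚ ℚ.≤ A → 1ℚ ℚ.≤ fromℕ T ℚ.* A
1≤fromℕ*A {T} {A} 1≤T 1≤A = ℚ.≤-trans 1≤A (ℚ.≤-trans (ℚ.≤-reflexive (sym (ℚ.*-identityˡ A)))
  (ℚ.*-monoʳ-≤-nonNeg A {{ℚ.nonNegative (ℚ.≤-trans (ℚ.nonNegative⁻¹ 1ℚ) 1≤A)}} (fromℕ-mono-≤ 1≤T)))

*-pos : ∀ p q → 0ℚ ℚ.< p → 0ℚ ℚ.< q → 0ℚ ℚ.< p ℚ.* q
*-pos p q 0<p 0<q =
  ℚ.positive⁻¹ (p ℚ.* q) {{ℚ.pos*pos⇒pos p {{ℚ.positive 0<p}} q {{ℚ.positive 0<q}}}}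

-- Every hypothesis on real numbers holds termwise from some index on. At one index `k` beyond all
-- of them they become rational inequalities in `e = seq ε k`, which `threshold` and `close-half-≰`
-- refute.
no-small-expansion : ∀ {c A e₀} →
  (∀ e v → 0ℚ ℚ.≤ e → e ℚ.≤ e₀ → 0ℚ ℚ.≤ v → v ℚ.≤ fromℕ c ℚ.* A ℚ.* e → v ℚ.≤ 1ℚ × v ℚ.* v ℚ.≤ ½ ℚ.* e) →
  ∀ (C ε : ℝ) → (∃ λ N → ∀ n → N ≤ n → seq C n ℚ.≤ A) → 0ℝ < ε → ε < fromℚ e₀ →
  ∀ {w h g u} → 0ℚ ℚ.< w → 0ℚ ℚ.≤ u → g ℚ.+ u ≡ 1ℚ →
  fromℚ h ≈ fromℚ w * ε → 1ℝ - C * ε < fromℚ g →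
  let v = fromℕ c ℚ.* u in
  ¬ (v ℚ.≤ 1ℚ → h ℚ.≤ w ℚ.* (v ℚ.* v))
no-small-expansion {c} {A} {e₀} threshold C ε (N₀ , C≤A) (δ , 0<δ , N₁ , δ≤ε) (δ₂ , 0<δ₂ , N₂ , ε<e₀)
  {w} {h} {g} {u} 0<w 0≤u g+u≡1 h≈wε (δ₃ , 0<δ₃ , N₃ , g-large) expansion =
  close-half-≰ w h e δ (v ℚ.* v) 0<w (proj₂ close k N₄≤k) δ≤e (proj₂ bounds) (expansion (proj₁ bounds))
  where
  -- The tolerance must be fixed before `k`, so it uses the gap `δ`, a lower bound for `e` at large
  -- indices, in place of `e`.
  close = h≈wε (w ℚ.* (½ ℚ.* δ)) (*-pos w (½ ℚ.* δ) 0<w (*-pos ½ δ (ℚ.positive⁻¹ ½) 0<δ))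
  N₄ = proj₁ close
  k = (N₀ ℕ.⊔ N₁) ℕ.⊔ ((N₂ ℕ.⊔ N₃) ℕ.⊔ N₄)
  N₀⊔N₁≤k = ℕ.m≤m⊔n (N₀ ℕ.⊔ N₁) ((N₂ ℕ.⊔ N₃) ℕ.⊔ N₄)
  rest≤k  = ℕ.m≤n⊔m (N₀ ℕ.⊔ N₁) ((N₂ ℕ.⊔ N₃) ℕ.⊔ N₄)
  N₂⊔N₃≤k = ℕ.m⊔n≤o⇒m≤o (N₂ ℕ.⊔ N₃) N₄ rest≤k
  N₄≤k    = ℕ.m⊔n≤o⇒n≤o (N₂ ℕ.⊔ N₃) N₄ rest≤k
  e = seq ε k
  v = fromℕ c ℚ.* u
  δ≤e : δ ℚ.≤ e
  δ≤e = subst (ℚ._≤ e) (ℚ.+-identityˡ δ) (δ≤ε k (ℕ.m⊔n≤o⇒n≤o N₀ N₁ N₀⊔N₁≤k))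
  0≤e : 0ℚ ℚ.≤ e
  0≤e = ℚ.≤-trans (ℚ.<⇒≤ 0<δ) δ≤e
  e≤e₀ : e ℚ.≤ e₀
  e≤e₀ = ℚ.≤-trans (p≤p+q e δ₂ 0<δ₂) (ε<e₀ k (ℕ.m⊔n≤o⇒m≤o N₂ N₃ N₂⊔N₃≤k))
  u≤Ae : u ℚ.≤ A ℚ.* e
  u≤Ae = complement-≤ g u (seq C k) A e 0≤e g+u≡1
    (ℚ.≤-trans (p≤p+q _ δ₃ 0<δ₃) (g-large k (ℕ.m⊔n≤o⇒n≤o N₂ N₃ N₂⊔N₃≤k)))
    (C≤A k (ℕ.m⊔n≤o⇒m≤o N₀ N₁ N₀⊔N₁≤k))
  0≤v : 0ℚ ℚ.≤ v
  0≤v = ℚ.nonNegative⁻¹ v {{ℚ.nonNeg*nonNeg⇒nonNeg (fromℕ c) u {{ℚ.nonNegative 0≤u}}}}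
  v≤cAe : v ℚ.≤ fromℕ c ℚ.* A ℚ.* e
  v≤cAe = subst (v ℚ.≤_) (sym (ℚ.*-assoc (fromℕ c) A e)) (ℚ.*-monoˡ-≤-nonNeg (fromℕ c) u≤Ae)
  bounds : v ℚ.≤ 1ℚ × v ℚ.* v ℚ.≤ ½ ℚ.* e
  bounds = threshold e v 0≤e e≤e₀ 0≤v v≤cAe

-- Existence of the pair

disagreeing-pair : ∀ t {A e₀} →
  (∀ e v → 0ℚ ℚ.≤ e → e ℚ.≤ e₀ → 0ℚ ℚ.≤ v → v ℚ.≤ fromℕ (2 ℕ.^ t) ℚ.* A ℚ.* e →
    v ℚ.≤ 1ℚ × v ℚ.* v ℚ.≤ ½ ℚ.* e) →
  ∀ (C : ℝ) → (∃ λ N → ∀ n → N ≤ n → seq C n ℚ.≤ A) →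
  ∀ (m : ℕ) .{{_ : NonZero m}} → 3 ≤ m →
  ∀ (n : ℕ) (ε : ℝ) → 0ℝ < ε → ε < fromℚ e₀ →
  ∀ (G H : Pred ([ m ]^ n) 0ℓ) (G? : Decidable G) (H? : Decidable H) →
  μ H? ≈ m ^- t * ε →
  1ℝ - C * ε < μ G? →
  ∃ λ x → ∃ λ y → G x × H y × agr x y ≡ 0
disagreeing-pair t threshold C C≤A (suc (suc (suc j))) (s≤s (s≤s (s≤s _))) n ε 0<ε ε<e₀ G H G? H? μH≈ G-large =
  -- The search over pairs is finite, so arguing by contradiction is constructively valid.
  decidable-stable (∃-point? λ x → ∃-point? λ y → G? x ×-dec H? y ×-dec agr x y ℕ.≟ 0) λ none →
    no-small-expansion threshold C ε C≤A 0<ε ε<e₀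
      (recip-pos ((3 ℕ.+ j) ℕ.^ t) {{ℕ.m^n≢0 (3 ℕ.+ j) t}})
      (density-nonNeg (∁? G?)) (density-∁ G?) μH≈ G-large
      -- `N` is taken to be the complement of `G`: without a pair as sought, a point disagreeing
      -- everywhere with a point of `H` cannot lie in `G`.
      (density-expansion j n t H? (∁? G?)
        λ x y Hy x#y Gx → none (x , y , Gx , Hy , disagree⇒agr≡0 x y x#y))

theorem2p3 : ∀ (t : ℕ) (C : ℝ) → 0ℝ < C →
    ∃ λ (ε₀ : ℝ) → 0ℝ < ε₀ ×
    (∀ (m : ℕ) .{{_ : NonZero m}} → 3 ≤ m →
    ∀ (n : ℕ) (ε : ℝ) → 0ℝ < ε → ε < ε₀ →
    ∀ (G H : Pred ([ m ]^ n) 0ℓ) (G? : Decidable G) (H? : Decidable H) →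
    μ H? ≈ m ^- t * ε →
    1ℝ - C * ε < μ G? →
    ∃ λ x → ∃ λ y → G x × H y × agr x y ≡ 0)
theorem2p3 t C _ =
  let A , 1≤A , C≤A = upper-bound C
      -- With `s = 2 ^ t * A`, the bound `u ≤ A * e` on the measure of the complement of `G` gives
      -- `v = 2 ^ t * u ≤ s * e`. Only `t` and `C` enter.
      e₀ , 0<e₀ , threshold =
        square-threshold (fromℕ (2 ℕ.^ t) ℚ.* A) (1≤fromℕ*A (ℕ.m^n>0 2 t) 1≤A)
  in fromℚ e₀ , (e₀ , 0<e₀ , 0 , λ _ _ → ℚ.≤-reflexive (ℚ.+-identityˡ e₀))
   , disagreeing-pair t threshold C C≤A
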